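{- For $m=3$ machines, consider the two-solution ordinal algorithm with the following two solutions. First solution: machine $1$ gets $\{6k+1:k\ge 0\}$; machine $2$ gets $\{6k+2:k\ge 0\}\cup\{6k+5:k\ge 0\}$; machine $3$ gets $\{6k+3:k\ge 0\}\cup\{6k+4:k\ge 0\}\cup\{6k+6:k\ge 0\}$. Second solution: machine $1$ gets $\{1\}\cup\{3k:k\ge 2\}$; machine $2$ gets $\{3k-1:k\ge 1\}$; machine $3$ gets $\{3\}\cup\{3k-2:k\ge 2\}$. The competitive ratio of this algorithm is at most $\frac43$.
   Context: Ordinal makespan scheduling on $m$ identical machines. Jobs are indexed by positive integers. A realization is a sequence of real job sizes $p_1\ge p_2\ge p_3\ge\cdots\ge 0$ with only finitely many positive sizes. A solution is a partition of the set of all positive integers into $m$ sets $J_1,\dots,J_m$, where $J_i$ is the set of jobs assigned to machine $i$; it is fixed without knowledge of the realization. For a realization, the load of machine $i$ in the solution is $\sum_{j\in J_i}p_j$, and the completion time of the solution is the maximum load of any machine. A two-solution ordinal algorithm consists of two solutions; its makespan for a realization is the minimum of the completion times of its two solutions for that realization. The optimal offline completion time $\lambda$ of a realization is the minimum completion time over all solutions (chosen with full knowledge of the realization). The competitive ratio of the algorithm is the supremum, over all realizations with $\lambda>0$, of the ratio between its makespan and $\lambda$. -}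

module Defs where

open import Data.Bool.Base using (if_then_else_)
open import Data.Fin.Base using (Fin; zero; suc)
open import Data.Fin.Patterns using (0F; 1F; 2F)
import Data.Fin.Properties as Fin
open import Data.Nat.Base as ℕ using (ℕ; zero; suc; NonZero)
import Data.Nat.DivMod as ℕ
import Data.Nat.Properties as ℕ
open import Data.Product.Base using (Σ; ∃; _×_; _,_)
open import Data.Rational.Base as ℚ using (ℚ; 0ℚ; 1ℚ; ½)
import Data.Rational.Properties as ℚ
open import Data.Rational.Solver using (module +-*-Solver)
open import Data.Sum.Base using (inj₁; inj₂)
open import Data.Vec.Functional as Vector using (Vector)
open import Relation.Binary.PropositionalEquality
  using (_≡_; refl; sym; trans; cong; subst)
open import Relation.Nullary using (¬_)
open import Relation.Nullary.Decidable.Core using (does)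

------------------------------------------------------------------------
-- Real numbers: Cauchy sequences of rationals, with _≈_ as equality

Cauchy : (ℕ → ℚ) → Set
Cauchy x = ∀ ε → 0ℚ ℚ.< ε →
  ∃ λ N → ∀ m n → N ℕ.≤ m → N ℕ.≤ n → ℚ.∣ x m ℚ.- x n ∣ ℚ.≤ ε

record ℝ : Set where
  constructor mkℝ
  field
    seq    : ℕ → ℚ
    cauchy : Cauchy seq

open ℝ public

infix 4 _≤_ _<_ _≈_

_<_ : ℝ → ℝ → Set
x < y = Σ ℚ λ ε → 0ℚ ℚ.< ε ×
  ∃ λ N → ∀ n → N ℕ.≤ n → seq x n ℚ.+ ε ℚ.≤ seq y n

_≤_ : ℝ → ℝ → Set
x ≤ y = ∀ ε → 0ℚ ℚ.< ε →
  ∃ λ N → ∀ n → N ℕ.≤ n → seq x n ℚ.≤ seq y n ℚ.+ ε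

_≈_ : ℝ → ℝ → Set
x ≈ y = x ≤ y × y ≤ x

private
  open +-*-Solver

  diff-swap : ∀ p q → ℚ.- (p ℚ.- q) ≡ q ℚ.- p
  diff-swap = solve 2 (λ p q → :- (p :- q) := q :- p) refl

  q+[p-q]≡p : ∀ p q → q ℚ.+ (p ℚ.- q) ≡ p
  q+[p-q]≡p = solve 2 (λ p q → q :+ (p :- q) := p) refl

  [q+e]-q≡e : ∀ q e → (q ℚ.+ e) ℚ.- q ≡ e
  [q+e]-q≡e = solve 2 (λ q e → (q :+ e) :- q := e) refl

  p≤∣p∣ : ∀ p → p ℚ.≤ ℚ.∣ p ∣
  p≤∣p∣ p with ℚ.≤-total 0ℚ p
  ... | inj₁ 0≤p = ℚ.≤-reflexive (sym (ℚ.0≤p⇒∣p∣≡p 0≤p))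
  ... | inj₂ p≤0 = ℚ.≤-trans p≤0 (ℚ.0≤∣p∣ p)

  p≤p+ε : ∀ {p ε} → 0ℚ ℚ.< ε → p ℚ.≤ p ℚ.+ ε
  p≤p+ε {p} {ε} ε>0 = subst (ℚ._≤ p ℚ.+ ε) (ℚ.+-identityʳ p)
    (ℚ.+-monoʳ-≤ p (ℚ.<⇒≤ ε>0))

  dist⇒≤ : ∀ p q {ε} → ℚ.∣ p ℚ.- q ∣ ℚ.≤ ε → p ℚ.≤ q ℚ.+ ε
  dist⇒≤ p q {ε} d = subst (ℚ._≤ q ℚ.+ ε) (q+[p-q]≡p p q)
    (ℚ.+-monoʳ-≤ q (ℚ.≤-trans (p≤∣p∣ (p ℚ.- q)) d))

  ≤⇒diff : ∀ p q {ε} → p ℚ.≤ q ℚ.+ ε → p ℚ.- q ℚ.≤ ε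
  ≤⇒diff p q {ε} p≤ = subst (p ℚ.- q ℚ.≤_) ([q+e]-q≡e q ε)
    (ℚ.+-monoˡ-≤ (ℚ.- q) p≤)

  ≤⇒dist : ∀ p q {ε} → p ℚ.≤ q ℚ.+ ε → q ℚ.≤ p ℚ.+ ε → ℚ.∣ p ℚ.- q ∣ ℚ.≤ ε
  ≤⇒dist p q {ε} p≤ q≤ with ℚ.∣p∣≡p∨∣p∣≡-p (p ℚ.- q)
  ... | inj₁ eq = subst (ℚ._≤ ε) (sym eq) (≤⇒diff p q p≤)
  ... | inj₂ eq = subst (ℚ._≤ ε) (sym (trans eq (diff-swap p q))) (≤⇒diff q p q≤)

  -- Exchanging m and n shows that the one-sided condition suffices.
  real : (x : ℕ → ℚ) →
    (∀ ε → 0ℚ ℚ.< ε →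
      ∃ λ N → ∀ m n → N ℕ.≤ m → N ℕ.≤ n → x m ℚ.≤ x n ℚ.+ ε) →
    ℝ
  real x h = mkℝ x λ ε ε>0 →
    let N , f = h ε ε>0
    in N , λ m n N≤m N≤n →
      ≤⇒dist (x m) (x n) (f m n N≤m N≤n) (f n m N≤n N≤m)

  ⊔-≤ : ∀ a b {c} → a ℕ.⊔ b ℕ.≤ c → a ℕ.≤ c × b ℕ.≤ c
  ⊔-≤ a b le =
    ℕ.≤-trans (ℕ.m≤m⊔n a b) le , ℕ.≤-trans (ℕ.m≤n⊔m a b) le

  *-pos : ∀ {p q} → 0ℚ ℚ.< p → 0ℚ ℚ.< q → 0ℚ ℚ.< p ℚ.* q
  *-pos {p} {q} p>0 q>0 = ℚ.positive⁻¹ (p ℚ.* q)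
    {{ℚ.pos*pos⇒pos p {{ℚ.positive p>0}} q {{ℚ.positive q>0}}}}

  -- An operation that is uniformly continuous along the tails of x and y
  -- acts on them termwise.
  lift₂ : (_∙_ : ℚ → ℚ → ℚ) (x y : ℝ) →
    (∀ ε → 0ℚ ℚ.< ε → Σ ℚ λ δ → 0ℚ ℚ.< δ × ∃ λ K → ∀ m n → K ℕ.≤ m → K ℕ.≤ n →
      ℚ.∣ seq x m ℚ.- seq x n ∣ ℚ.≤ δ → ℚ.∣ seq y m ℚ.- seq y n ∣ ℚ.≤ δ →
      (seq x m ∙ seq y m) ℚ.≤ (seq x n ∙ seq y n) ℚ.+ ε) →
    ℝ
  lift₂ _∙_ x y h = real (λ n → seq x n ∙ seq y n) (λ ε ε>0 →
    let δ , δ>0 , K , f = h ε ε>0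
        M , g = cauchy x δ δ>0
        N , k = cauchy y δ δ>0
    in (M ℕ.⊔ N) ℕ.⊔ K , λ m n ≤m ≤n →
      let MN≤m , K≤m = ⊔-≤ (M ℕ.⊔ N) K ≤m
          MN≤n , K≤n = ⊔-≤ (M ℕ.⊔ N) K ≤n
          M≤m , N≤m = ⊔-≤ M N MN≤m
          M≤n , N≤n = ⊔-≤ M N MN≤n
      in f m n K≤m K≤n (g m n M≤m M≤n) (k m n N≤m N≤n))

  ⊔-shift : ∀ p q ε → (p ℚ.+ ε) ℚ.⊔ (q ℚ.+ ε) ≡ (p ℚ.⊔ q) ℚ.+ ε
  ⊔-shift p q ε = sym (ℚ.mono-≤-distrib-⊔ {f = ℚ._+ ε} (ℚ.+-monoˡ-≤ ε) p q)

  ⊓-shift : ∀ p q ε → (p ℚ.+ ε) ℚ.⊓ (q ℚ.+ ε) ≡ (p ℚ.⊓ q) ℚ.+ ε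
  ⊓-shift p q ε = sym (ℚ.mono-≤-distrib-⊓ {f = ℚ._+ ε} (ℚ.+-monoˡ-≤ ε) p q)

  bounded : ∀ x → Σ ℚ λ B → 0ℚ ℚ.< B × ∃ λ N → ∀ n → N ℕ.≤ n → ℚ.∣ seq x n ∣ ℚ.≤ B
  bounded x with cauchy x 1ℚ (ℚ.positive⁻¹ 1ℚ)
  ... | N , f = a ℚ.+ 1ℚ , ℚ.+-mono-≤-< (ℚ.0≤∣p∣ (seq x N)) (ℚ.positive⁻¹ 1ℚ) , N , λ n N≤n →
      begin
        ℚ.∣ seq x n ∣                            ≡⟨ cong ℚ.∣_∣ (q+[p-q]≡p (seq x n) (seq x N)) ⟨
        ℚ.∣ seq x N ℚ.+ (seq x n ℚ.- seq x N) ∣  ≤⟨ ℚ.∣p+q∣≤∣p∣+∣q∣ (seq x N) (seq x n ℚ.- seq x N) ⟩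
        a ℚ.+ ℚ.∣ seq x n ℚ.- seq x N ∣          ≤⟨ ℚ.+-monoʳ-≤ a (f n N N≤n ℕ.≤-refl) ⟩
        a ℚ.+ 1ℚ                                 ∎
    where
    open ℚ.≤-Reasoning
    a = ℚ.∣ seq x N ∣

  ∣*∣-mono : ∀ p q {a b} → ℚ.∣ p ∣ ℚ.≤ a → ℚ.∣ q ∣ ℚ.≤ b → ℚ.∣ p ℚ.* q ∣ ℚ.≤ a ℚ.* b
  ∣*∣-mono p q {a} {b} p≤a q≤b = begin
    ℚ.∣ p ℚ.* q ∣          ≡⟨ ℚ.∣p*q∣≡∣p∣*∣q∣ p q ⟩
    ℚ.∣ p ∣ ℚ.* ℚ.∣ q ∣    ≤⟨ ℚ.*-monoʳ-≤-nonNeg ℚ.∣ q ∣ {{ℚ.∣-∣-nonNeg q}} p≤a ⟩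
    a ℚ.* ℚ.∣ q ∣          ≤⟨ ℚ.*-monoˡ-≤-nonNeg a {{ℚ.nonNegative (ℚ.≤-trans (ℚ.0≤∣p∣ p) p≤a)}} q≤b ⟩
    a ℚ.* b                ∎
    where open ℚ.≤-Reasoning

fromℚ : ℚ → ℝ
fromℚ q = real (λ _ → q) (λ ε ε>0 → 0 , λ _ _ _ _ → p≤p+ε ε>0)

0ℝ : ℝ
0ℝ = fromℚ 0ℚ

infixl 6 _+_ _⊔_
infixl 7 _*_ _⊓_ _÷_
infix 8 _⁻¹

_+_ : ℝ → ℝ → ℝ
x + y = lift₂ ℚ._+_ x y λ ε ε>0 →
  ½ ℚ.* ε , *-pos (ℚ.positive⁻¹ ½) ε>0 , 0 , λ m n _ _ dx dy →
  let open ℚ.≤-Reasoning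
      a = seq x m ; b = seq y m ; c = seq x n ; d = seq y n
  in begin
    a ℚ.+ b                                  ≤⟨ ℚ.+-mono-≤ (dist⇒≤ a c dx) (dist⇒≤ b d dy) ⟩
    (c ℚ.+ ½ ℚ.* ε) ℚ.+ (d ℚ.+ ½ ℚ.* ε)      ≡⟨ halves c d ε ⟩
    (c ℚ.+ d) ℚ.+ ε                          ∎
  where
  halves : ∀ c d ε → (c ℚ.+ ½ ℚ.* ε) ℚ.+ (d ℚ.+ ½ ℚ.* ε) ≡ (c ℚ.+ d) ℚ.+ ε
  halves = solve 3 (λ c d ε →
    (c :+ con ½ :* ε) :+ (d :+ con ½ :* ε) := (c :+ d) :+ ε) refl

_⊔_ : ℝ → ℝ → ℝ
x ⊔ y = lift₂ ℚ._⊔_ x y λ ε ε>0 → ε , ε>0 , 0 , λ m n _ _ dx dy →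
  subst (seq x m ℚ.⊔ seq y m ℚ.≤_) (⊔-shift (seq x n) (seq y n) ε)
    (ℚ.⊔-mono-≤ (dist⇒≤ (seq x m) (seq x n) dx) (dist⇒≤ (seq y m) (seq y n) dy))

_⊓_ : ℝ → ℝ → ℝ
x ⊓ y = lift₂ ℚ._⊓_ x y λ ε ε>0 → ε , ε>0 , 0 , λ m n _ _ dx dy →
  subst (seq x m ℚ.⊓ seq y m ℚ.≤_) (⊓-shift (seq x n) (seq y n) ε)
    (ℚ.⊓-mono-≤ (dist⇒≤ (seq x m) (seq x n) dx) (dist⇒≤ (seq y m) (seq y n) dy))

_*_ : ℝ → ℝ → ℝ
x * y = lift₂ ℚ._*_ x y λ ε ε>0 →
  let A , A>0 , M , f = bounded x
      B , B>0 , N , g = bounded y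
      C>0 = ℚ.+-mono-< A>0 B>0
      instance
        C-pos = ℚ.positive C>0
        C-nz = ℚ.pos⇒nonZero (A ℚ.+ B)
      r = ℚ.1/ (A ℚ.+ B)
      r>0 = ℚ.positive⁻¹ r {{ℚ.1/pos⇒pos (A ℚ.+ B)}}
      δ = r ℚ.* ε
  in δ , *-pos r>0 ε>0 , M ℕ.⊔ N , λ m n ≤m ≤n dx dy →
  let open ℚ.≤-Reasoning
      M≤m , _ = ⊔-≤ M N ≤m
      _ , N≤n = ⊔-≤ M N ≤n
      a = seq x m ; b = seq y m ; c = seq x n ; d = seq y n
  in begin
    a ℚ.* b                                          ≡⟨ expand a b c d ⟩
    c ℚ.* d ℚ.+ (a ℚ.* (b ℚ.- d) ℚ.+ (a ℚ.- c) ℚ.* d)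
      ≤⟨ ℚ.+-monoʳ-≤ (c ℚ.* d) (ℚ.+-mono-≤
           (ℚ.≤-trans (p≤∣p∣ _) (∣*∣-mono a (b ℚ.- d) (f m M≤m) dy))
           (ℚ.≤-trans (p≤∣p∣ _) (∣*∣-mono (a ℚ.- c) d dx (g n N≤n)))) ⟩
    c ℚ.* d ℚ.+ (A ℚ.* δ ℚ.+ δ ℚ.* B)                ≡⟨ cong (c ℚ.* d ℚ.+_) (collect A B r ε) ⟩
    c ℚ.* d ℚ.+ ((A ℚ.+ B) ℚ.* r) ℚ.* ε
      ≡⟨ cong (λ t → c ℚ.* d ℚ.+ t ℚ.* ε) (ℚ.*-inverseʳ (A ℚ.+ B)) ⟩
    c ℚ.* d ℚ.+ 1ℚ ℚ.* ε                             ≡⟨ cong (c ℚ.* d ℚ.+_) (ℚ.*-identityˡ ε) ⟩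
    c ℚ.* d ℚ.+ ε                                    ∎
  where
  expand : ∀ a b c d → a ℚ.* b ≡ c ℚ.* d ℚ.+ (a ℚ.* (b ℚ.- d) ℚ.+ (a ℚ.- c) ℚ.* d)
  expand = solve 4 (λ a b c d →
    a :* b := c :* d :+ (a :* (b :- d) :+ (a :- c) :* d)) refl
  collect : ∀ A B r ε → A ℚ.* (r ℚ.* ε) ℚ.+ (r ℚ.* ε) ℚ.* B ≡ ((A ℚ.+ B) ℚ.* r) ℚ.* ε
  collect = solve 4 (λ A B r ε →
    A :* (r :* ε) :+ (r :* ε) :* B := ((A :+ B) :* r) :* ε) refl

-- The reciprocal of p, cut off below at ε > 0.
recip : ∀ ε → 0ℚ ℚ.< ε → ℚ → ℚ
recip ε ε>0 p = ℚ.1/_ (p ℚ.⊔ ε)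
  {{ℚ.pos⇒nonZero (p ℚ.⊔ ε) {{ℚ.positive (ℚ.<-≤-trans ε>0 (ℚ.p≤q⊔p p ε))}}}}

recip-inverse : ∀ ε ε>0 p → recip ε ε>0 p ℚ.* (p ℚ.⊔ ε) ≡ 1ℚ
recip-inverse ε ε>0 p = ℚ.*-inverseˡ (p ℚ.⊔ ε)
  {{ℚ.pos⇒nonZero (p ℚ.⊔ ε) {{ℚ.positive (ℚ.<-≤-trans ε>0 (ℚ.p≤q⊔p p ε))}}}}

private
  recip-≤ : ∀ ε (ε>0 : 0ℚ ℚ.< ε) p q η → 0ℚ ℚ.< η →
    q ℚ.≤ p ℚ.+ η ℚ.* (ε ℚ.* ε) →
    recip ε ε>0 p ℚ.≤ recip ε ε>0 q ℚ.+ η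
  recip-≤ ε ε>0 p q η η>0 q≤ =
    ℚ.*-cancelʳ-≤-pos (a ℚ.* b) {{ℚ.positive (*-pos a>0 b>0)}} (begin
      r ℚ.* (a ℚ.* b)                        ≡⟨ ℚ.*-assoc r a b ⟨
      r ℚ.* a ℚ.* b                          ≡⟨ cong (ℚ._* b) (recip-inverse ε ε>0 p) ⟩
      1ℚ ℚ.* b                               ≡⟨ ℚ.*-identityˡ b ⟩
      b                                      ≤⟨ b≤ ⟩
      a ℚ.+ η ℚ.* (ε ℚ.* ε)                  ≤⟨ ℚ.+-monoʳ-≤ a (ℚ.*-monoˡ-≤-nonNeg η {{ℚ.nonNegative (ℚ.<⇒≤ η>0)}} εε≤ab) ⟩
      a ℚ.+ η ℚ.* (a ℚ.* b)                  ≡⟨ cong (ℚ._+ η ℚ.* (a ℚ.* b)) (ℚ.*-identityˡ a) ⟨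
      1ℚ ℚ.* a ℚ.+ η ℚ.* (a ℚ.* b)
        ≡⟨ cong (λ t → t ℚ.* a ℚ.+ η ℚ.* (a ℚ.* b)) (recip-inverse ε ε>0 q) ⟨
      s ℚ.* b ℚ.* a ℚ.+ η ℚ.* (a ℚ.* b)      ≡⟨ factor a b s η ⟩
      (s ℚ.+ η) ℚ.* (a ℚ.* b)                ∎)
    where
    open ℚ.≤-Reasoning
    a = p ℚ.⊔ ε
    b = q ℚ.⊔ ε
    r = recip ε ε>0 p
    s = recip ε ε>0 q
    a>0 = ℚ.<-≤-trans ε>0 (ℚ.p≤q⊔p p ε)
    b>0 = ℚ.<-≤-trans ε>0 (ℚ.p≤q⊔p q ε)
    δ>0 : 0ℚ ℚ.< η ℚ.* (ε ℚ.* ε)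
    δ>0 = *-pos η>0 (*-pos ε>0 ε>0)
    εε≤ab : ε ℚ.* ε ℚ.≤ a ℚ.* b
    εε≤ab = ℚ.≤-trans
      (ℚ.*-monoʳ-≤-nonNeg ε {{ℚ.nonNegative (ℚ.<⇒≤ ε>0)}} (ℚ.p≤q⊔p p ε))
      (ℚ.*-monoˡ-≤-nonNeg a {{ℚ.nonNegative (ℚ.<⇒≤ a>0)}} (ℚ.p≤q⊔p q ε))
    b≤ : b ℚ.≤ a ℚ.+ η ℚ.* (ε ℚ.* ε)
    b≤ = subst (b ℚ.≤_) (⊔-shift p ε (η ℚ.* (ε ℚ.* ε)))
      (ℚ.⊔-mono-≤ q≤ (p≤p+ε δ>0))
    factor : ∀ a b s η → s ℚ.* b ℚ.* a ℚ.+ η ℚ.* (a ℚ.* b) ≡ (s ℚ.+ η) ℚ.* (a ℚ.* b)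
    factor = solve 4 (λ a b s η →
      s :* b :* a :+ η :* (a :* b) := (s :+ η) :* (a :* b)) refl

-- Since seq x n ≥ ε for all large n, the cut-off at ε changes only
-- finitely many terms.
_⁻¹ : (x : ℝ) → {{0ℝ < x}} → ℝ
(x ⁻¹) {{ε , ε>0 , _}} = real (λ n → recip ε ε>0 (seq x n)) (λ η η>0 →
  let N , f = cauchy x (η ℚ.* (ε ℚ.* ε)) (*-pos η>0 (*-pos ε>0 ε>0))
  in N , λ m n N≤m N≤n →
    recip-≤ ε ε>0 (seq x m) (seq x n) η η>0
      (dist⇒≤ (seq x n) (seq x m) (f n m N≤n N≤m)))

⁻¹-inverseʳ : ∀ x {{x>0 : 0ℝ < x}} → x * x ⁻¹ ≈ fromℚ 1ℚ
⁻¹-inverseʳ x {{ε , ε>0 , N , ε≤x}} =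
  (λ η η>0 → N , λ n N≤n → subst (ℚ._≤ 1ℚ ℚ.+ η) (sym (inverse n N≤n)) (p≤p+ε η>0)) ,
  (λ η η>0 → N , λ n N≤n → subst (λ t → 1ℚ ℚ.≤ t ℚ.+ η) (sym (inverse n N≤n)) (p≤p+ε η>0))
  where
  inverse : ∀ n → N ℕ.≤ n → seq x n ℚ.* recip ε ε>0 (seq x n) ≡ 1ℚ
  inverse n N≤n = trans (ℚ.*-comm (seq x n) _) (trans
    (cong (recip ε ε>0 (seq x n) ℚ.*_) (sym (ℚ.p≥q⇒p⊔q≡p
      (subst (ℚ._≤ seq x n) (ℚ.+-identityˡ ε) (ε≤x n N≤n)))))
    (recip-inverse ε ε>0 (seq x n)))

_÷_ : (x y : ℝ) → {{0ℝ < y}} → ℝ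
x ÷ y = x * y ⁻¹

------------------------------------------------------------------------
-- Ordinal makespan scheduling

record Realization : Set where
  field
    size       : (j : ℕ) → .{{NonZero j}} → ℝ
    decreasing : ∀ j → .{{_ : NonZero j}} → size (suc j) ≤ size j
    nonneg     : ∀ j → .{{_ : NonZero j}} → 0ℝ ≤ size j
    bound      : ℕ
    finite     : ∀ j → .{{_ : NonZero j}} → bound ℕ.< j → size j ≈ 0ℝ

open Realization public

-- A partition of the positive integers into m (possibly empty) sets,
-- given by the index of the set containing each job.
Solution : ℕ → Set
Solution m = (j : ℕ) → .{{NonZero j}} → Fin m

-- ∑ n f = f 1 + ⋯ + f n
∑ : ℕ → ((j : ℕ) → .{{NonZero j}} → ℝ) → ℝ
∑ zero    f = 0ℝ
∑ (suc n) f = ∑ n f + f (suc n)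

-- Jobs beyond the bound have size zero, so the sum over J_i may stop there.
load : ∀ {m} → Realization → Solution m → Fin m → ℝ
load p S i = ∑ (bound p) λ j → if does (S j Fin.≟ i) then size p j else 0ℝ

maximum : ∀ {n} → Vector ℝ (suc n) → ℝ
maximum v = Vector.foldr _⊔_ (Vector.head v) (Vector.tail v)

completionTime : ∀ {n} → Realization → Solution (suc n) → ℝ
completionTime p S = maximum (load p S)

-- The second component is doubly negated because a minimising solution
-- cannot be selected constructively by comparing real numbers; classically
-- this says exactly that λ* is the minimum of the completion times on
-- suc n machines.
IsOptimal : ℕ → Realization → ℝ → Set
IsOptimal n p λ* =
  (∀ (S : Solution (suc n)) → λ* ≤ completionTime p S) ×
  ¬ ¬ (∃ λ (S : Solution (suc n)) → completionTime p S ≈ λ*)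

record Algorithm (m : ℕ) : Set where
  constructor _∥_
  field
    solution₁ solution₂ : Solution m

open Algorithm public

makespan : ∀ {n} → Algorithm (suc n) → Realization → ℝ
makespan A p = completionTime p (solution₁ A) ⊓ completionTime p (solution₂ A)

-- The supremum of the ratios is at most r iff r is an upper bound for them.
CompetitiveRatioAtMost : ∀ {n} → Algorithm (suc n) → ℝ → Set
CompetitiveRatioAtMost {n} A r =
  ∀ (p : Realization) (λ* : ℝ) → IsOptimal n p λ* →
  {{_ : 0ℝ < λ*}} → makespan A p ÷ λ* ≤ r

------------------------------------------------------------------------
-- The two solutions for three machines

residue₆ : ℕ → Fin 3
residue₆ 1 = 0F
residue₆ 2 = 1F
residue₆ 5 = 1F
residue₆ _ = 2F

first : Solution 3
first j = residue₆ (j ℕ.% 6)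

residue₃ : ℕ → Fin 3
residue₃ 0 = 0F
residue₃ 2 = 1F
residue₃ _ = 2F

second : Solution 3
second 1 = 0F
second 3 = 2F
second j = residue₃ (j ℕ.% 3)

twoSolutions : Algorithm 3
twoSolutions = first ∥ second

first-6k+1 : ∀ k → first (1 ℕ.+ k ℕ.* 6) ≡ 0F
first-6k+1 k = cong residue₆ (ℕ.[m+kn]%n≡m%n 1 k 6)

first-6k+2 : ∀ k → first (2 ℕ.+ k ℕ.* 6) ≡ 1F
first-6k+2 k = cong residue₆ (ℕ.[m+kn]%n≡m%n 2 k 6)

first-6k+3 : ∀ k → first (3 ℕ.+ k ℕ.* 6) ≡ 2F
first-6k+3 k = cong residue₆ (ℕ.[m+kn]%n≡m%n 3 k 6)

first-6k+4 : ∀ k → first (4 ℕ.+ k ℕ.* 6) ≡ 2F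
first-6k+4 k = cong residue₆ (ℕ.[m+kn]%n≡m%n 4 k 6)

first-6k+5 : ∀ k → first (5 ℕ.+ k ℕ.* 6) ≡ 1F
first-6k+5 k = cong residue₆ (ℕ.[m+kn]%n≡m%n 5 k 6)

first-6k+6 : ∀ k → first (6 ℕ.+ k ℕ.* 6) ≡ 2F
first-6k+6 k = cong residue₆ (ℕ.[m+kn]%n≡m%n 6 k 6)

second-1 : second 1 ≡ 0F
second-1 = refl

second-3 : second 3 ≡ 2F
second-3 = refl

second-3k+6 : ∀ k → second (6 ℕ.+ k ℕ.* 3) ≡ 0F
second-3k+6 k = cong residue₃ (ℕ.[m+kn]%n≡m%n 6 k 3)

second-3k+2 : ∀ k → second (2 ℕ.+ k ℕ.* 3) ≡ 1F
second-3k+2 zero    = refl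
second-3k+2 (suc k) = cong residue₃ (ℕ.[m+kn]%n≡m%n 5 k 3)

second-3k+4 : ∀ k → second (4 ℕ.+ k ℕ.* 3) ≡ 2F
second-3k+4 k = cong residue₃ (ℕ.[m+kn]%n≡m%n 4 k 3)

{-# OPTIONS --safe #-}

-- Write p₁ ≥ p₂ ≥ ⋯ ≥ 0 for the sizes, T for their sum, Λ for an upper bound
-- on the loads of some solution, and Aᵢ, Bᵢ for the loads of machine i in the
-- first and the second solution. Then p₁ ≤ Λ and T ≤ 3Λ, and p₃ + p₄ ≤ Λ
-- because two of the jobs 1, …, 4 share a machine. Comparing how many jobs of
-- each prefix 1, …, n both sides contain, summation by parts gives
--   6A₁ ≤ T + 5p₁,  3A₂ ≤ T + p₁,  3B₂ ≤ T + p₁,  3B₃ ≤ T + p₃ + p₄,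
--   4A₃ + 3B₁ ≤ 3T.
-- So every load but A₃ and B₁ is at most 4Λ/3, and min(A₃, B₁) ≤ 9Λ/7 ≤ 4Λ/3.
--
-- For real sizes the argument runs at each late index n of the Cauchy
-- sequences. There the rational approximations are decreasing and nonnegative
-- up to some δ only; passing to their envelope changes them by at most a
-- constant times δ. Finally ≤ on ℝ is ¬¬-stable, so an optimal solution may be
-- assumed to be given.

module Submission where

open import Defs hiding (_≤_; _<_; _≈_; _+_; _*_; _⊔_; _⊓_)
import Defs as ℝ
open import Data.Bool.Base using (true; false; if_then_else_)
open import Data.Fin.Base using (Fin; toℕ)
open import Data.Fin.Patterns using (0F; 1F; 2F)
import Data.Fin.Properties as Fin
open import Data.Integer.Base using (+_)
open import Data.Nat.Base as ℕ using (ℕ; zero; suc; z≤n; s≤s)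
import Data.Nat.Properties as ℕ
open import Data.Product.Base using (∃; _×_; _,_; proj₁; proj₂)
open import Data.Rational.Base
  using (ℚ; 0ℚ; 1ℚ; _/_; _+_; _*_; _-_; _≤_; _<_; _⊔_; _⊓_; 1/_; ∣_∣; NonZero;
         positive; nonNegative; Positive)
open import Data.Rational.Properties
open import Data.Rational.Solver using (module +-*-Solver)
open import Data.Sum.Base using (_⊎_; inj₁; inj₂)
open import Data.Vec.Functional using (Vector)
open import Function.Base using (_∘_; case_of_)
open import Relation.Binary.PropositionalEquality
  using (_≡_; _≢_; refl; sym; trans; cong; cong₂; subst; subst₂)
open import Relation.Nullary using (¬_; yes; no; contradiction)
open import Relation.Nullary.Decidable using (does; True; toWitness; from-yes; decidable-stable)

open +-*-Solver
open ≤-Reasoning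

-- Order lemmas for rational arithmetic.

*-monoʳ : ∀ {p q r} → 0ℚ ≤ p → q ≤ r → p * q ≤ p * r
*-monoʳ {p} 0≤p = *-monoˡ-≤-nonNeg p {{nonNegative 0≤p}}

*-monoˡ : ∀ {p q r} → 0ℚ ≤ p → q ≤ r → q * p ≤ r * p
*-monoˡ {p} 0≤p = *-monoʳ-≤-nonNeg p {{nonNegative 0≤p}}

*-nonneg : ∀ {p q} → 0ℚ ≤ p → 0ℚ ≤ q → 0ℚ ≤ p * q
*-nonneg {p} 0≤p 0≤q = subst (_≤ p * _) (*-zeroʳ p) (*-monoʳ 0≤p 0≤q)

*-positive : ∀ {p q} → 0ℚ < p → 0ℚ < q → 0ℚ < p * q
*-positive {p} {q} 0<p 0<q = positive⁻¹ (p * q)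
  {{pos*pos⇒pos p {{positive 0<p}} q {{positive 0<q}}}}

p≤q⇒0≤q-p : ∀ {p q} → p ≤ q → 0ℚ ≤ q - p
p≤q⇒0≤q-p {p} {q} p≤q = subst (_≤ q - p) (+-inverseʳ p) (+-monoˡ-≤ _ p≤q)

p≤p+q : ∀ {p q} → 0ℚ ≤ q → p ≤ p + q
p≤p+q {p} {q} 0≤q = subst (_≤ p + q) (+-identityʳ p) (+-monoʳ-≤ p 0≤q)

0≤1 : 0ℚ ≤ 1ℚ
0≤1 = from-yes (0ℚ ≤? 1ℚ)

-- Weighted sums of sizes.

sum : ℕ → (ℕ → ℚ) → ℚ
sum zero    f = 0ℚ
sum (suc n) f = sum n f + f n

dot : ℕ → (ℕ → ℚ) → (ℕ → ℚ) → ℚ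
dot zero    u q = 0ℚ
dot (suc n) u q = dot n u q + u n * q n

dot-mono : ∀ n {u v q r} → (∀ j → j ℕ.< n → u j * q j ≤ v j * r j) → dot n u q ≤ dot n v r
dot-mono zero    u*q≤v*r = ≤-refl
dot-mono (suc n) u*q≤v*r =
  +-mono-≤ (dot-mono n λ j j<n → u*q≤v*r j (ℕ.m≤n⇒m≤1+n j<n)) (u*q≤v*r n ℕ.≤-refl)

dot-zero : ∀ n {u q} → (∀ j → j ℕ.< n → u j ≡ 0ℚ) → dot n u q ≡ 0ℚ
dot-zero zero            u≡0 = refl
dot-zero (suc n) {q = q} u≡0 = cong₂ _+_
  (dot-zero n λ j j<n → u≡0 j (ℕ.m≤n⇒m≤1+n j<n))
  (trans (cong (_* q n) (u≡0 n ℕ.≤-refl)) (*-zeroˡ (q n)))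

dot-extend : ∀ k n {u q} → (∀ j → n ℕ.≤ j → q j ≡ 0ℚ) → dot (k ℕ.+ n) u q ≡ dot n u q
dot-extend zero    n     q≡0 = refl
dot-extend (suc k) n {u} q≡0 = trans
  (cong₂ _+_ (dot-extend k n q≡0)
    (trans (cong (u (k ℕ.+ n) *_) (q≡0 (k ℕ.+ n) (ℕ.m≤n+m n k))) (*-zeroʳ (u (k ℕ.+ n)))))
  (+-identityʳ _)

one : ℕ → ℚ
one _ = 1ℚ

-- The natural number `n` as a rational.
count : ℕ → ℚ
count n = sum n one

count-nonneg : ∀ n → 0ℚ ≤ count n
count-nonneg zero    = ≤-refl
count-nonneg (suc n) = +-mono-≤ (count-nonneg n) 0≤1

dot-+ : ∀ n u v {q} → dot n (λ j → u j + v j) q ≡ dot n u q + dot n v q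
dot-+ zero    u v     = refl
dot-+ (suc n) u v {q} = trans (cong (_+ (u n + v n) * q n) (dot-+ n u v))
  (solve 5 (λ a b c d e → (a :+ b) :+ (c :+ d) :* e := (a :+ c :* e) :+ (b :+ d :* e))
    refl (dot n u q) (dot n v q) (u n) (v n) (q n))

dot-* : ∀ n c u {q} → dot n (λ j → c * u j) q ≡ c * dot n u q
dot-* zero    c u     = sym (*-zeroʳ c)
dot-* (suc n) c u {q} = trans (cong (_+ c * u n * q n) (dot-* n c u))
  (solve 4 (λ a b c d → c :* a :+ c :* b :* d := c :* (a :+ b :* d))
    refl (dot n u q) (u n) c (q n))

-- Summation by parts and domination of prefix sums.

Antitone Nonneg : (ℕ → ℚ) → Set
Antitone q = ∀ j → q (suc j) ≤ q j
Nonneg   q = ∀ j → 0ℚ ≤ q j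

antitone-≤ : ∀ {q} → Antitone q → ∀ {m n} → m ℕ.≤ n → q n ≤ q m
antitone-≤ {q} anti m≤n = go (ℕ.≤⇒≤′ m≤n)
  where
  go : ∀ {m n} → m ℕ.≤′ n → q n ≤ q m
  go ℕ.≤′-refl       = ≤-refl
  go (ℕ.≤′-step m≤n) = ≤-trans (anti _) (go m≤n)

dot-monoˡ : ∀ n {u v q} → Nonneg q → (∀ j → u j ≤ v j) → dot n u q ≤ dot n v q
dot-monoˡ n q≥0 u≤v = dot-mono n λ j _ → *-monoˡ (q≥0 j) (u≤v j)

dot-monoʳ : ∀ n {u q r} → Nonneg u → (∀ j → j ℕ.< n → q j ≤ r j) → dot n u q ≤ dot n u r
dot-monoʳ n u≥0 q≤r = dot-mono n λ j j<n → *-monoʳ (u≥0 j) (q≤r j j<n)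

infix 4 _≼_

_≼_ : (u v : ℕ → ℚ) → Set
u ≼ v = ∀ n → sum n u ≤ sum n v

-- Summation by parts: dot v q - dot u q is a combination of the prefix
-- differences sum v - sum u with weights q j - q (suc j), and q n for the last one.
≼⇒dot-≤ : ∀ {u v q} → u ≼ v → Antitone q → Nonneg q → ∀ n → dot n u q ≤ dot n v q
≼⇒dot-≤ {u} {v} {q} u≼v anti q≥0 n =
  ≤-trans (p≤p+q (*-nonneg (p≤q⇒0≤q-p (u≼v n)) (q≥0 n))) (parts n)
  where
  parts : ∀ n → dot n u q + (sum n v - sum n u) * q n ≤ dot n v q
  parts zero    = ≤-reflexive (trans (+-identityˡ _) (*-zeroˡ (q 0)))
  parts (suc n) = begin
    dot (suc n) u q + (sum (suc n) v - sum (suc n) u) * q (suc n)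
      ≤⟨ +-monoʳ-≤ (dot (suc n) u q) (*-monoʳ (p≤q⇒0≤q-p (u≼v (suc n))) (anti n)) ⟩
    dot (suc n) u q + (sum (suc n) v - sum (suc n) u) * q n
      ≡⟨ solve 6 (λ d s t a b x →
           (d :+ a :* x) :+ ((t :+ b) :- (s :+ a)) :* x := (d :+ (t :- s) :* x) :+ b :* x)
           refl (dot n u q) (sum n u) (sum n v) (u n) (v n) (q n) ⟩
    dot n u q + (sum n v - sum n u) * q n + v n * q n
      ≤⟨ +-monoˡ-≤ (v n * q n) (parts n) ⟩
    dot (suc n) v q ∎

-- Both sides grow by c over each period from index 6 on.
periodic-≼ : ∀ u v c →
  (∀ n → u (12 ℕ.+ n) ≡ u (6 ℕ.+ n)) → sum 12 u ≡ sum 6 u + c →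
  (∀ n → v (12 ℕ.+ n) ≡ v (6 ℕ.+ n)) → sum 12 v ≡ sum 6 v + c →
  {_ : True (ℕ.allUpTo? (λ n → sum n u ≤? sum n v) 12)} → u ≼ v
periodic-≼ u v c u-periodic u-step v-periodic v-step {t} = all
  where
  -- The implicit argument is solved by evaluation at each use. Lengths 6 to 11 start the induction
  -- by steps of 6, a common period of both solutions after the irregular start of the second.
  small : ∀ {n} → n ℕ.< 12 → sum n u ≤ sum n v
  small = toWitness t

  shift : ∀ {w} → (∀ n → w (12 ℕ.+ n) ≡ w (6 ℕ.+ n)) → sum 12 w ≡ sum 6 w + c →
    ∀ n → sum (12 ℕ.+ n) w ≡ sum (6 ℕ.+ n) w + c
  shift     periodic step zero    = step
  shift {w} periodic step (suc n) = trans
    (cong₂ _+_ (shift periodic step n) (periodic n))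
    (solve 3 (λ a b c → (a :+ c) :+ b := (a :+ b) :+ c) refl (sum (6 ℕ.+ n) w) (w (6 ℕ.+ n)) c)

  late : ∀ n → sum (6 ℕ.+ n) u ≤ sum (6 ℕ.+ n) v
  late (suc (suc (suc (suc (suc (suc n)))))) =
    subst₂ _≤_ (sym (shift u-periodic u-step n)) (sym (shift v-periodic v-step n))
      (+-monoˡ-≤ c (late n))
  late 0 = small (from-yes (6 ℕ.<? 12))
  late 1 = small (from-yes (7 ℕ.<? 12))
  late 2 = small (from-yes (8 ℕ.<? 12))
  late 3 = small (from-yes (9 ℕ.<? 12))
  late 4 = small (from-yes (10 ℕ.<? 12))
  late 5 = small (from-yes (11 ℕ.<? 12))

  all : u ≼ v
  all n with n ℕ.<? 12
  ... | yes n<12 = small n<12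
  ... | no  n≮12 = subst (λ m → sum m u ≤ sum m v)
    (ℕ.m+[n∸m]≡n (ℕ.≤-trans (ℕ.m≤m+n 6 6) (ℕ.≮⇒≥ n≮12))) (late (n ℕ.∸ 6))

-- Prefix counts of the two solutions.

-- Positions count from 0, so position j holds job suc j.
indicator : ∀ {m} → Solution m → Fin m → ℕ → ℚ
indicator S i j = if does (S (suc j) Fin.≟ i) then 1ℚ else 0ℚ

-- The Kronecker delta. By structural recursion it evaluates to `0ℚ` at `6 + n` for each `a` used
-- below, so periodicity holds by `refl`.
unit : ℕ → ℕ → ℚ
unit zero    zero    = 1ℚ
unit zero    (suc _) = 0ℚ
unit (suc _) zero    = 0ℚ
unit (suc a) (suc j) = unit a j

-- Prefixes of length 6k+1 contain k+1 jobs of this machine and give equality, which fixes the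
-- surplus 5 on job 1.
first₀-≼ : (λ j → (+ 6 / 1) * indicator first 0F j) ≼ (λ j → one j + (+ 5 / 1) * unit 0 j)
first₀-≼ = periodic-≼ _ _ (+ 6 / 1) (λ _ → refl) refl (λ _ → refl) refl

first₁-≼ : (λ j → (+ 3 / 1) * indicator first 1F j) ≼ (λ j → one j + unit 0 j)
first₁-≼ = periodic-≼ _ _ (+ 6 / 1) (λ _ → refl) refl (λ _ → refl) refl

-- Machine 2 holds the same jobs in both solutions, those congruent to 2 modulo 3.
second₁-≼ : (λ j → (+ 3 / 1) * indicator second 1F j) ≼ (λ j → one j + unit 0 j)
second₁-≼ = periodic-≼ _ _ (+ 6 / 1) (λ _ → refl) refl (λ _ → refl) refl

-- The surplus 2 is needed from prefix 4 on. It sits on jobs 3 and 4, which together cost one Λ; on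
-- job 1 it could cost two.
second₂-≼ : (λ j → (+ 3 / 1) * indicator second 2F j) ≼ (λ j → one j + (unit 2 j + unit 3 j))
second₂-≼ = periodic-≼ _ _ (+ 6 / 1) (λ _ → refl) refl (λ _ → refl) refl

-- Either load alone can exceed 4Λ/3: six equal jobs overload A₃, and one large job followed by many
-- tiny ones of twice its size in total overloads B₁. The weights 4 and 3 give equality at prefixes
-- 1 and 6.
first₂-second₀-≼ :
  (λ j → (+ 4 / 1) * indicator first 2F j + (+ 3 / 1) * indicator second 0F j)
    ≼ (λ j → (+ 3 / 1) * one j)
first₂-second₀-≼ = periodic-≼ _ _ (+ 18 / 1) (λ _ → refl) refl (λ _ → refl) refl

-- Contributions of single jobs and pairs to a load.

indicator-nonneg : ∀ {m} (S : Solution m) i → Nonneg (indicator S i)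
indicator-nonneg S i j with S (suc j) Fin.≟ i
... | yes _ = 0≤1
... | no  _ = ≤-refl

indicator-≤1 : ∀ {m} (S : Solution m) i j → indicator S i j ≤ 1ℚ
indicator-≤1 S i j with S (suc j) Fin.≟ i
... | yes _ = ≤-refl
... | no  _ = 0≤1

one-≤-indicators : ∀ (S : Solution 3) j →
  one j ≤ indicator S 0F j + (indicator S 1F j + indicator S 2F j)
one-≤-indicators S j with S (suc j)
... | 0F = ≤-refl
... | 1F = ≤-refl
... | 2F = ≤-refl

unit-self : ∀ a → unit a a ≡ 1ℚ
unit-self zero    = refl
unit-self (suc a) = unit-self a

unit-other : ∀ a j → j ≢ a → unit a j ≡ 0ℚ
unit-other zero    zero    j≢a = contradiction refl j≢a
unit-other zero    (suc _) _   = refl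
unit-other (suc _) zero    _   = refl
unit-other (suc a) (suc j) j≢a = unit-other a j (j≢a ∘ cong suc)

dot-unit : ∀ {a n q} → a ℕ.< n → dot n (unit a) q ≡ q a
dot-unit {a} {suc n} {q} (s≤s a≤n) with n ℕ.≟ a
... | yes refl = trans
  (cong₂ _+_
    (dot-zero n λ j j<n → unit-other n j (ℕ.<⇒≢ j<n))
    (trans (cong (_* q n) (unit-self n)) (*-identityˡ (q n))))
  (+-identityˡ (q n))
... | no n≢a = trans
  (cong₂ _+_
    (dot-unit (ℕ.≤∧≢⇒< a≤n (n≢a ∘ sym)))
    (trans (cong (_* q n) (unit-other a n n≢a)) (*-zeroˡ (q n))))
  (+-identityʳ (q a))

indicator-member : ∀ {m} (S : Solution m) {j i} → S (suc j) ≡ i → indicator S i j ≡ 1ℚ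
indicator-member S {j} {i} Sj≡i with S (suc j) Fin.≟ i
... | yes _   = refl
... | no Sj≢i = contradiction Sj≡i Sj≢i

unit-≤-indicator : ∀ {m} (S : Solution m) {a i} → S (suc a) ≡ i →
  ∀ j → unit a j ≤ indicator S i j
unit-≤-indicator S {a} {i} Sa≡i j with j ℕ.≟ a
... | no j≢a   = subst (_≤ indicator S i j) (sym (unit-other a j j≢a)) (indicator-nonneg S i j)
... | yes refl = ≤-reflexive (trans (unit-self j) (sym (indicator-member S Sa≡i)))

-- Since `a < b`, at most one of the two units is nonzero at any position.
units-≤-indicator : ∀ {m} (S : Solution m) {a b i} → a ℕ.< b → S (suc a) ≡ i → S (suc b) ≡ i →
  ∀ j → unit a j + unit b j ≤ indicator S i j
units-≤-indicator S {a} {b} {i} a<b Sa≡i Sb≡i j with j ℕ.≟ b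
... | no j≢b   = begin
  unit a j + unit b j   ≡⟨ cong (λ x → unit a j + x) (unit-other b j j≢b) ⟩
  unit a j + 0ℚ         ≡⟨ +-identityʳ (unit a j) ⟩
  unit a j              ≤⟨ unit-≤-indicator S Sa≡i j ⟩
  indicator S i j       ∎
... | yes refl = begin
  unit a j + unit j j   ≡⟨ cong (_+ unit j j) (unit-other a j (ℕ.<⇒≢ a<b ∘ sym)) ⟩
  0ℚ + unit j j         ≡⟨ +-identityˡ (unit j j) ⟩
  unit j j              ≤⟨ unit-≤-indicator S Sb≡i j ⟩
  indicator S i j       ∎

-- The bound for exactly decreasing nonnegative sizes.

-- Machine `0F` comes last because `maximum` folds from the right starting with the head.
maxLoad : ℕ → Solution 3 → (ℕ → ℚ) → ℚ
maxLoad n S q =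
  dot n (indicator S 1F) q ⊔ (dot n (indicator S 2F) q ⊔ dot n (indicator S 0F) q)

maxLoad-lub : ∀ n S {q c} → dot n (indicator S 0F) q ≤ c → dot n (indicator S 1F) q ≤ c →
  dot n (indicator S 2F) q ≤ c → maxLoad n S q ≤ c
maxLoad-lub n S load₀≤c load₁≤c load₂≤c = ⊔-lub load₁≤c (⊔-lub load₂≤c load₀≤c)

load≤maxLoad : ∀ n S {q} i → dot n (indicator S i) q ≤ maxLoad n S q
load≤maxLoad n S {q} = λ where
    0F → ≤-trans (p≤q⊔p (L 2F) (L 0F)) (p≤q⊔p (L 1F) (L 2F ⊔ L 0F))
    1F → p≤p⊔q (L 1F) (L 2F ⊔ L 0F)
    2F → ≤-trans (p≤p⊔q (L 2F) (L 0F)) (p≤q⊔p (L 1F) (L 2F ⊔ L 0F))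
  where
  L : Fin 3 → ℚ
  L i = dot n (indicator S i) q

-- The smaller of two numbers is at most their mean with weights 4/7 and 3/7.
weighted-mean-≤ : ∀ {a b c} → (+ 4 / 1) * a + (+ 3 / 1) * b ≤ (+ 7 / 1) * c → a ≤ c ⊎ b ≤ c
weighted-mean-≤ {a} {b} {c} mean≤ with ≤-total a b
... | inj₁ a≤b = inj₁ (*-cancelˡ-≤-pos (+ 7 / 1) (begin
  (+ 7 / 1) * a                 ≡⟨ *-distribʳ-+ a (+ 4 / 1) (+ 3 / 1) ⟩
  (+ 4 / 1) * a + (+ 3 / 1) * a ≤⟨ +-monoʳ-≤ ((+ 4 / 1) * a) (*-monoˡ-≤-nonNeg (+ 3 / 1) a≤b) ⟩
  (+ 4 / 1) * a + (+ 3 / 1) * b ≤⟨ mean≤ ⟩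
  (+ 7 / 1) * c                 ∎))
... | inj₂ b≤a = inj₂ (*-cancelˡ-≤-pos (+ 7 / 1) (begin
  (+ 7 / 1) * b                 ≡⟨ *-distribʳ-+ b (+ 4 / 1) (+ 3 / 1) ⟩
  (+ 4 / 1) * b + (+ 3 / 1) * b ≤⟨ +-monoˡ-≤ ((+ 3 / 1) * b) (*-monoˡ-≤-nonNeg (+ 4 / 1) b≤a) ⟩
  (+ 4 / 1) * a + (+ 3 / 1) * b ≤⟨ mean≤ ⟩
  (+ 7 / 1) * c                 ∎))

module _ {q : ℕ → ℚ} (anti : Antitone q) (q≥0 : Nonneg q) {n : ℕ} (4≤n : 4 ℕ.≤ n)
         (S : Solution 3) {Λ : ℚ} (load≤Λ : ∀ i → dot n (indicator S i) q ≤ Λ) where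

  private
    L : Solution 3 → Fin 3 → ℚ
    L A i = dot n (indicator A i) q
    T = dot n one q
    c = (+ 4 / 3) * Λ

    a<4⇒a<n : ∀ {a} → a ℕ.< 4 → a ℕ.< n
    a<4⇒a<n a<4 = ℕ.≤-trans a<4 4≤n

    0<n : 0 ℕ.< n
    0<n = a<4⇒a<n (s≤s z≤n)

  largest-≤ : q 0 ≤ Λ
  largest-≤ = begin
    q 0                  ≡⟨ dot-unit 0<n ⟨
    dot n (unit 0) q     ≤⟨ dot-monoˡ n q≥0 (unit-≤-indicator S refl) ⟩
    L S (S 1)            ≤⟨ load≤Λ (S 1) ⟩
    Λ                    ∎

  third+fourth-≤ : q 2 + q 3 ≤ Λ
  third+fourth-≤ with i , j , i<j , same ← Fin.pigeonhole (ℕ.n<1+n 3) (λ i → S (suc (toℕ i))) =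
    let a = toℕ i ; b = toℕ j
        b≤3 = Fin.toℕ≤pred[n] j
    in begin
    q 2 + q 3
      -- From `a < b ≤ 3` follows `a ≤ 2`, so these two jobs are at least as large as the third and
      -- the fourth.
      ≤⟨ +-mono-≤ (antitone-≤ anti (ℕ.≤-pred (ℕ.≤-trans i<j b≤3))) (antitone-≤ anti b≤3) ⟩
    q a + q b
      ≡⟨ cong₂ _+_ (dot-unit (a<4⇒a<n (Fin.toℕ<n i))) (dot-unit (a<4⇒a<n (Fin.toℕ<n j))) ⟨
    dot n (unit a) q + dot n (unit b) q
      ≡⟨ dot-+ n (unit a) (unit b) ⟨
    dot n (λ j → unit a j + unit b j) q
      ≤⟨ dot-monoˡ n q≥0 (units-≤-indicator S i<j same refl) ⟩
    L S (S (suc b))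
      ≤⟨ load≤Λ (S (suc b)) ⟩
    Λ ∎

  total-≤ : T ≤ (+ 3 / 1) * Λ
  total-≤ = begin
    T
      ≤⟨ dot-monoˡ n q≥0 (one-≤-indicators S) ⟩
    dot n (λ j → indicator S 0F j + (indicator S 1F j + indicator S 2F j)) q
      ≡⟨ trans (dot-+ n (indicator S 0F) _) (cong (λ x → L S 0F + x)
           (dot-+ n (indicator S 1F) (indicator S 2F))) ⟩
    L S 0F + (L S 1F + L S 2F)
      ≤⟨ +-mono-≤ (load≤Λ 0F) (+-mono-≤ (load≤Λ 1F) (load≤Λ 2F)) ⟩
    Λ + (Λ + Λ)
      ≡⟨ solve 1 (λ Λ → Λ :+ (Λ :+ Λ) := con (+ 3 / 1) :* Λ) refl Λ ⟩
    (+ 3 / 1) * Λ ∎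

  first₀-≤ : L first 0F ≤ c
  first₀-≤ = *-cancelˡ-≤-pos (+ 6 / 1) (begin
    (+ 6 / 1) * L first 0F
      ≡⟨ dot-* n (+ 6 / 1) (indicator first 0F) ⟨
    dot n (λ j → (+ 6 / 1) * indicator first 0F j) q
      ≤⟨ ≼⇒dot-≤ first₀-≼ anti q≥0 n ⟩
    dot n (λ j → one j + (+ 5 / 1) * unit 0 j) q
      ≡⟨ trans (dot-+ n one (λ j → (+ 5 / 1) * unit 0 j)) (cong (λ x → T + x)
           (trans (dot-* n (+ 5 / 1) (unit 0)) (cong ((+ 5 / 1) *_) (dot-unit 0<n)))) ⟩
    T + (+ 5 / 1) * q 0
      ≤⟨ +-mono-≤ total-≤ (*-monoˡ-≤-nonNeg (+ 5 / 1) largest-≤) ⟩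
    (+ 3 / 1) * Λ + (+ 5 / 1) * Λ
      ≡⟨ solve 1 (λ Λ → con (+ 3 / 1) :* Λ :+ con (+ 5 / 1) :* Λ
           := con (+ 6 / 1) :* (con (+ 4 / 3) :* Λ)) refl Λ ⟩
    (+ 6 / 1) * c ∎)

  private
    -- The common end of three bounds: a surplus worth at most Λ gives 3L ≤ T + Λ ≤ 4Λ.
    third-≤ : ∀ A i v {x} → (λ j → (+ 3 / 1) * indicator A i j) ≼ (λ j → one j + v j) →
      dot n v q ≡ x → x ≤ Λ → L A i ≤ c
    third-≤ A i v {x} dominated v·q≡x x≤Λ = *-cancelˡ-≤-pos (+ 3 / 1) (begin
      (+ 3 / 1) * L A i                             ≡⟨ dot-* n (+ 3 / 1) (indicator A i) ⟨
      dot n (λ j → (+ 3 / 1) * indicator A i j) q   ≤⟨ ≼⇒dot-≤ dominated anti q≥0 n ⟩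
      dot n (λ j → one j + v j) q                   ≡⟨ dot-+ n one v ⟩
      T + dot n v q                                 ≡⟨ cong (λ x → T + x) v·q≡x ⟩
      T + x                                         ≤⟨ +-mono-≤ total-≤ x≤Λ ⟩
      (+ 3 / 1) * Λ + Λ
        ≡⟨ solve 1 (λ Λ → con (+ 3 / 1) :* Λ :+ Λ := con (+ 3 / 1) :* (con (+ 4 / 3) :* Λ)) refl Λ ⟩
      (+ 3 / 1) * c                                 ∎)

  first₁-≤ : L first 1F ≤ c
  first₁-≤ = third-≤ first 1F (unit 0) first₁-≼ (dot-unit 0<n) largest-≤

  second₁-≤ : L second 1F ≤ c
  second₁-≤ = third-≤ second 1F (unit 0) second₁-≼ (dot-unit 0<n) largest-≤

  second₂-≤ : L second 2F ≤ c
  second₂-≤ = third-≤ second 2F (λ j → unit 2 j + unit 3 j) second₂-≼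
    (trans (dot-+ n (unit 2) (unit 3))
      (cong₂ _+_ (dot-unit (a<4⇒a<n (from-yes (2 ℕ.<? 4))))
        (dot-unit (a<4⇒a<n (from-yes (3 ℕ.<? 4))))))
    third+fourth-≤

  first₂-second₀-≤ : L first 2F ≤ c ⊎ L second 0F ≤ c
  first₂-second₀-≤ = weighted-mean-≤ (begin
    (+ 4 / 1) * L first 2F + (+ 3 / 1) * L second 0F
      ≡⟨ trans (dot-+ n (λ j → (+ 4 / 1) * indicator first 2F j) _)
           (cong₂ _+_ (dot-* n (+ 4 / 1) (indicator first 2F))
             (dot-* n (+ 3 / 1) (indicator second 0F))) ⟨
    dot n (λ j → (+ 4 / 1) * indicator first 2F j + (+ 3 / 1) * indicator second 0F j) q
      ≤⟨ ≼⇒dot-≤ first₂-second₀-≼ anti q≥0 n ⟩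
    dot n (λ j → (+ 3 / 1) * one j) q
      ≡⟨ dot-* n (+ 3 / 1) one ⟩
    (+ 3 / 1) * T
      ≤⟨ *-monoˡ-≤-nonNeg (+ 3 / 1) total-≤ ⟩
    (+ 3 / 1) * ((+ 3 / 1) * Λ)
      -- The slack between 9Λ and 7 · 4Λ/3 is Λ/3, nonnegative because 0 ≤ `q 0` ≤ Λ.
      ≤⟨ p≤p+q (*-monoˡ-≤-nonNeg (+ 1 / 3) (≤-trans (q≥0 0) largest-≤)) ⟩
    (+ 3 / 1) * ((+ 3 / 1) * Λ) + (+ 1 / 3) * Λ
      ≡⟨ solve 1 (λ Λ → con (+ 3 / 1) :* (con (+ 3 / 1) :* Λ) :+ con (+ 1 / 3) :* Λ
           := con (+ 7 / 1) :* (con (+ 4 / 3) :* Λ)) refl Λ ⟩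
    (+ 7 / 1) * c ∎)

  -- Whichever of A₃ and B₁ is small selects the solution all of whose loads are small.
  maxLoads-≤ : maxLoad n first q ⊓ maxLoad n second q ≤ c
  maxLoads-≤ = case first₂-second₀-≤ of λ where
    (inj₁ first₂-≤) → ≤-trans (p⊓q≤p (maxLoad n first q) (maxLoad n second q))
      (maxLoad-lub n first first₀-≤ first₁-≤ first₂-≤)
    (inj₂ second₀-≤) → ≤-trans (p⊓q≤q (maxLoad n first q) (maxLoad n second q))
      (maxLoad-lub n second second₀-≤ second₁-≤ second₂-≤)

-- Approximately decreasing sizes and their envelope.

-- The least antitone and nonnegative majorant of q 0, …, q (k - 1).
envelope : ℕ → (ℕ → ℚ) → ℕ → ℚ
envelope zero    q j       = 0ℚ
envelope (suc k) q zero    = q 0 ⊔ envelope k (q ∘ suc) 0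
envelope (suc k) q (suc j) = envelope k (q ∘ suc) j

envelope-antitone : ∀ k q → Antitone (envelope k q)
envelope-antitone zero    q j       = ≤-refl
envelope-antitone (suc k) q zero    = p≤q⊔p (q 0) (envelope k (q ∘ suc) 0)
envelope-antitone (suc k) q (suc j) = envelope-antitone k (q ∘ suc) j

envelope-zero : ∀ k q j → k ℕ.≤ j → envelope k q j ≡ 0ℚ
envelope-zero zero    q j       _         = refl
envelope-zero (suc k) q (suc j) (s≤s k≤j) = envelope-zero k (q ∘ suc) j k≤j

-- Position `j` is compared with position `j + k`, where the antitone envelope has already reached
-- zero.
envelope-nonneg : ∀ k q → Nonneg (envelope k q)
envelope-nonneg k q j = subst (_≤ envelope k q j)
  (envelope-zero k q (j ℕ.+ k) (ℕ.m≤n+m k j))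
  (antitone-≤ (envelope-antitone k q) (ℕ.m≤m+n j k))

≤-envelope : ∀ k q j → j ℕ.< k → q j ≤ envelope k q j
≤-envelope (suc k) q zero    _         = p≤p⊔q (q 0) (envelope k (q ∘ suc) 0)
≤-envelope (suc k) q (suc j) (s≤s j<k) = ≤-envelope k (q ∘ suc) j j<k

-- The envelope at `j` is the largest of 0 and the values of `q` from `j` to `k - 1`. Each step
-- forward gains at most δ, and 0 exceeds `q j` by at most δ.
envelope-≤ : ∀ k {q δ} → 0ℚ ≤ δ →
  (∀ j → j ℕ.< k → q (suc j) ≤ q j + δ) → (∀ j → j ℕ.< k → 0ℚ ≤ q j + δ) →
  ∀ j → j ℕ.< k → envelope k q j ≤ q j + count k * δ
envelope-≤ (suc k) {q} {δ} 0≤δ decreasing nonneg (suc j) (s≤s j<k) = begin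
  envelope k (q ∘ suc) j
    ≤⟨ envelope-≤ k {q ∘ suc} 0≤δ (λ j j<k → decreasing (suc j) (s≤s j<k))
         (λ j j<k → nonneg (suc j) (s≤s j<k)) j j<k ⟩
  q (suc j) + count k * δ
    ≤⟨ +-monoʳ-≤ (q (suc j)) (*-monoˡ 0≤δ (p≤p+q {count k} 0≤1)) ⟩
  q (suc j) + count (suc k) * δ ∎
envelope-≤ (suc k) {q} {δ} 0≤δ decreasing nonneg zero _ =
  ⊔-lub (p≤p+q {q 0} (*-nonneg (count-nonneg (suc k)) 0≤δ)) (second-≤ k decreasing nonneg)
  where
  second-≤ : ∀ k → (∀ j → j ℕ.< suc k → q (suc j) ≤ q j + δ) →
    (∀ j → j ℕ.< suc k → 0ℚ ≤ q j + δ) → envelope k (q ∘ suc) 0 ≤ q 0 + count (suc k) * δ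
  -- The induction hypothesis reaches only positions below the remaining length; at length 0 the
  -- envelope is `0ℚ`, and `nonneg` bounds it.
  second-≤ zero decreasing nonneg =
    subst (0ℚ ≤_) (cong (λ x → q 0 + x) (sym (*-identityˡ δ))) (nonneg 0 (s≤s z≤n))
  second-≤ (suc k) decreasing nonneg = begin
    envelope (suc k) (q ∘ suc) 0
      ≤⟨ envelope-≤ (suc k) {q ∘ suc} 0≤δ (λ j j<k → decreasing (suc j) (s≤s j<k))
           (λ j j<k → nonneg (suc j) (s≤s j<k)) 0 (s≤s z≤n) ⟩
    q 1 + count (suc k) * δ
      ≤⟨ +-monoˡ-≤ (count (suc k) * δ) (decreasing 0 (s≤s z≤n)) ⟩
    q 0 + δ + count (suc k) * δ
      ≡⟨ solve 3 (λ q δ c → q :+ δ :+ c :* δ := q :+ (c :+ con 1ℚ) :* δ)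
           refl (q 0) δ (count (suc k)) ⟩
    q 0 + count (suc (suc k)) * δ ∎

dot-indicator-translate : ∀ {m} (S : Solution m) i n {q e} → 0ℚ ≤ e →
  dot n (indicator S i) (λ j → q j + e) ≤ dot n (indicator S i) q + count n * e
dot-indicator-translate S i zero    {q} {e} 0≤e =
  ≤-reflexive (sym (trans (+-identityˡ _) (*-zeroˡ e)))
dot-indicator-translate S i (suc n) {q} {e} 0≤e = begin
  dot n u (λ j → q j + e) + u n * (q n + e)
    ≤⟨ +-monoˡ-≤ (u n * (q n + e)) (dot-indicator-translate S i n 0≤e) ⟩
  dot n u q + count n * e + u n * (q n + e)
    ≡⟨ solve 5 (λ d c e u q → d :+ c :* e :+ u :* (q :+ e) := d :+ u :* q :+ (c :+ u) :* e)
         refl (dot n u q) (count n) e (u n) (q n) ⟩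
  dot n u q + u n * q n + (count n + u n) * e
    ≤⟨ +-monoʳ-≤ (dot n u q + u n * q n)
         (*-monoˡ 0≤e (+-monoʳ-≤ (count n) (indicator-≤1 S i n))) ⟩
  dot n u q + u n * q n + count (suc n) * e ∎
  where
  u = indicator S i

-- The envelope majorizes `x`, so the loads of the algorithm can only grow. Those of `S` grow by at
-- most `count k * δ` for each of at most `k` jobs, hence the two factors `count k`.
approximate-maxLoads-≤ : ∀ k {x δ Λ} → 0ℚ ≤ δ →
  (∀ j → j ℕ.< k → x (suc j) ≤ x j + δ) → (∀ j → j ℕ.< k → 0ℚ ≤ x j + δ) →
  ∀ (S : Solution 3) → (∀ i → dot k (indicator S i) x ≤ Λ) →
  maxLoad k first x ⊓ maxLoad k second x ≤ (+ 4 / 3) * (Λ + count k * (count k * δ))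
approximate-maxLoads-≤ k {x} {δ} {Λ} 0≤δ decreasing nonneg S load≤Λ =
  ≤-trans (⊓-mono-≤ (maxLoad≤ first) (maxLoad≤ second))
    -- Four extra positions of size zero supply jobs 1 to 4 even when `k` is less than 4.
    (maxLoads-≤ (envelope-antitone k x) (envelope-nonneg k x) (ℕ.m≤m+n 4 k) S envelope-load≤)
  where
  q = envelope k x
  e = count k * δ

  extend : ∀ (A : Solution 3) i → dot (4 ℕ.+ k) (indicator A i) q ≡ dot k (indicator A i) q
  extend A i = dot-extend 4 k (envelope-zero k x)

  load≤ : ∀ (A : Solution 3) i → dot k (indicator A i) x ≤ dot (4 ℕ.+ k) (indicator A i) q
  load≤ A i = ≤-trans (dot-monoʳ k (indicator-nonneg A i) (≤-envelope k x))
    (≤-reflexive (sym (extend A i)))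

  maxLoad≤ : ∀ A → maxLoad k A x ≤ maxLoad (4 ℕ.+ k) A q
  maxLoad≤ A = ⊔-mono-≤ (load≤ A 1F) (⊔-mono-≤ (load≤ A 2F) (load≤ A 0F))

  envelope-load≤ : ∀ i → dot (4 ℕ.+ k) (indicator S i) q ≤ Λ + count k * e
  envelope-load≤ i = begin
    dot (4 ℕ.+ k) (indicator S i) q             ≡⟨ extend S i ⟩
    dot k (indicator S i) q
      ≤⟨ dot-monoʳ k (indicator-nonneg S i) (envelope-≤ k 0≤δ decreasing nonneg) ⟩
    dot k (indicator S i) (λ j → x j + e)
      ≤⟨ dot-indicator-translate S i k (*-nonneg (count-nonneg k) 0≤δ) ⟩
    dot k (indicator S i) x + count k * e       ≤⟨ +-monoˡ-≤ (count k * e) (load≤Λ i) ⟩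
    Λ + count k * e                             ∎

-- Eventual properties and stability of the order on the reals.

Eventually : (ℕ → Set) → Set
Eventually P = ∃ λ N → ∀ n → N ℕ.≤ n → P n

_∧_ : ∀ {P Q} → Eventually P → Eventually Q → Eventually (λ n → P n × Q n)
(M , p) ∧ (N , q) = M ℕ.⊔ N , λ n M⊔N≤n →
  p n (ℕ.≤-trans (ℕ.m≤m⊔n M N) M⊔N≤n) , q n (ℕ.≤-trans (ℕ.m≤n⊔m M N) M⊔N≤n)

eventually-∀< : ∀ {P : ℕ → ℕ → Set} k → (∀ j → Eventually (P j)) →
  Eventually (λ n → ∀ j → j ℕ.< k → P j n)
eventually-∀< zero    p = 0 , λ n _ j ()
eventually-∀< {P} (suc k) p =
  let N , f = eventually-∀< {P} k p ∧ p k in N , λ n N≤n j j<1+k →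
    case ℕ.m≤n⇒m<n∨m≡n (ℕ.≤-pred j<1+k) of λ where
      (inj₁ j<k)  → proj₁ (f n N≤n) j j<k
      (inj₂ refl) → proj₂ (f n N≤n)

-- The index `N` must be found without a proof of `x ≤ y`, so it comes from the Cauchy moduli alone.
-- At each `n` the rational comparison is decidable, and refuting its failure may use `x ≤ y` at a
-- later index.
≤-stable : ∀ {x y} → ¬ ¬ (x ℝ.≤ y) → x ℝ.≤ y
≤-stable {x} {y} ¬¬x≤y ε 0<ε = N , λ n N≤n →
  decidable-stable (seq x n ≤? seq y n + ε) λ x≰y → ¬¬x≤y λ x≤y →
    let K , x≤y+δ = x≤y δ 0<δ
        m = N ℕ.⊔ K
        N≤m = ℕ.m≤m⊔n N K
    in x≰y (begin
      seq x n
        ≤⟨ close x (proj₁ (cauchy′ n m N≤n N≤m)) ⟩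
      seq x m + δ
        ≤⟨ +-monoˡ-≤ δ (x≤y+δ m (ℕ.m≤n⊔m N K)) ⟩
      seq y m + δ + δ
        ≤⟨ +-monoˡ-≤ δ (+-monoˡ-≤ δ (close y (proj₂ (cauchy′ m n N≤m N≤n)))) ⟩
      seq y n + δ + δ + δ
        ≡⟨ solve 2 (λ y ε → y :+ con (+ 1 / 3) :* ε :+ con (+ 1 / 3) :* ε :+ con (+ 1 / 3) :* ε
             := y :+ ε) refl (seq y n) ε ⟩
      seq y n + ε ∎)
  where
  -- One third each for moving `x` from `n` to `m`, comparing at `m`, and moving `y` back to `n`.
  δ = (+ 1 / 3) * ε
  0<δ : 0ℚ < δ
  0<δ = *-positive (positive⁻¹ (+ 1 / 3)) 0<ε

  Nx = proj₁ (cauchy x δ 0<δ)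
  Ny = proj₁ (cauchy y δ 0<δ)
  N = Nx ℕ.⊔ Ny

  cauchy′ : ∀ m n → N ℕ.≤ m → N ℕ.≤ n → ∣ seq x m - seq x n ∣ ≤ δ × ∣ seq y m - seq y n ∣ ≤ δ
  cauchy′ m n N≤m N≤n =
    proj₂ (cauchy x δ 0<δ) m n (ℕ.m⊔n≤o⇒m≤o Nx Ny N≤m) (ℕ.m⊔n≤o⇒m≤o Nx Ny N≤n) ,
    proj₂ (cauchy y δ 0<δ) m n (ℕ.m⊔n≤o⇒n≤o Nx Ny N≤m) (ℕ.m⊔n≤o⇒n≤o Nx Ny N≤n)

  p≤∣p∣ : ∀ p → p ≤ ∣ p ∣
  p≤∣p∣ p with ≤-total 0ℚ p
  ... | inj₁ 0≤p = ≤-reflexive (sym (0≤p⇒∣p∣≡p 0≤p))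
  ... | inj₂ p≤0 = ≤-trans p≤0 (0≤∣p∣ p)

  close : ∀ z {m n} → ∣ seq z m - seq z n ∣ ≤ δ → seq z m ≤ seq z n + δ
  close z {m} {n} near = begin
    seq z m
      ≡⟨ solve 2 (λ p q → p := q :+ (p :- q)) refl (seq z m) (seq z n) ⟩
    seq z n + (seq z m - seq z n)
      ≤⟨ +-monoʳ-≤ (seq z n) (≤-trans (p≤∣p∣ _) near) ⟩
    seq z n + δ ∎

-- Rational approximations of loads and completion times.

seq-+ : ∀ x y n → seq (x ℝ.+ y) n ≡ seq x n + seq y n
seq-+ x y n = refl

seq-⊓ : ∀ x y n → seq (x ℝ.⊓ y) n ≡ seq x n ⊓ seq y n
seq-⊓ x y n = refl

seq-maximum : ∀ (v : Vector ℝ 3) n →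
  seq (maximum v) n ≡ seq (v 1F) n ⊔ (seq (v 2F) n ⊔ seq (v 0F) n)
seq-maximum v n = refl

seq-if : ∀ b x n → seq (if b then x else 0ℝ) n ≡ (if b then 1ℚ else 0ℚ) * seq x n
seq-if true  x n = sym (*-identityˡ (seq x n))
seq-if false x n = sym (*-zeroˡ (seq x n))

sizes : Realization → ℕ → ℕ → ℚ
sizes p n j = seq (size p (suc j)) n

seq-load : ∀ {m} p (S : Solution m) i n →
  seq (load p S i) n ≡ dot (bound p) (indicator S i) (sizes p n)
seq-load p S i n = go (bound p)
  where
  summand : (j : ℕ) → .{{ℕ.NonZero j}} → ℝ
  summand j = if does (S j Fin.≟ i) then size p j else 0ℝ

  term : ∀ j → seq (summand (suc j)) n ≡ indicator S i j * sizes p n j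
  term j = seq-if (does (S (suc j) Fin.≟ i)) (size p (suc j)) n

  go : ∀ k → seq (∑ k summand) n ≡ dot k (indicator S i) (sizes p n)
  go zero    = refl
  go (suc k) = trans (seq-+ (∑ k summand) (summand (suc k)) n) (cong₂ _+_ (go k) (term k))

seq-completionTime : ∀ p (S : Solution 3) n →
  seq (completionTime p S) n ≡ maxLoad (bound p) S (sizes p n)
seq-completionTime p S n = trans (seq-maximum (load p S) n)
  (cong₂ _⊔_ (seq-load p S 1F n) (cong₂ _⊔_ (seq-load p S 2F n) (seq-load p S 0F n)))

-- Passage to real sizes and the competitive ratio.

makespan-≤ : ∀ p (S : Solution 3) Λ → completionTime p S ℝ.≤ Λ → ∀ η → 0ℚ < η →
  Eventually (λ n → seq (makespan twoSolutions p) n ≤ (+ 4 / 3) * seq Λ n + η)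
makespan-≤ p S Λ time≤Λ η 0<η =
  -- Only the `k` sizes up to the bound enter the loads, so finitely many eventual conditions have a
  -- common index.
  let N , f = (eventually-∀< k (λ j → decreasing p (suc j) δ 0<δ) ∧
               eventually-∀< k (λ j → nonneg p (suc j) δ 0<δ)) ∧ time≤Λ δ 0<δ
  in N , λ n N≤n →
    let (decreasing-n , nonneg-n) , time≤ = f n N≤n
        x = sizes p n
        load≤ : ∀ i → dot k (indicator S i) x ≤ seq Λ n + δ
        load≤ i = ≤-trans (load≤maxLoad k S i)
          (subst (_≤ seq Λ n + δ) (seq-completionTime p S n) time≤)
    in begin
      seq (makespan twoSolutions p) n
        ≡⟨ trans (seq-⊓ (completionTime p first) (completionTime p second) n)
             (cong₂ _⊓_ (seq-completionTime p first n) (seq-completionTime p second n)) ⟩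
      maxLoad k first x ⊓ maxLoad k second x
        ≤⟨ approximate-maxLoads-≤ k (<⇒≤ 0<δ) decreasing-n nonneg-n S load≤ ⟩
      (+ 4 / 3) * (seq Λ n + δ + c * (c * δ))
        ≡⟨ solve 4 (λ Λ c r η → con (+ 4 / 3) :* (Λ :+ r :* η :+ c :* (c :* (r :* η)))
             := con (+ 4 / 3) :* Λ :+ r :* (con (+ 4 / 3) :* (con 1ℚ :+ c :* c)) :* η)
             refl (seq Λ n) c r η ⟩
      (+ 4 / 3) * seq Λ n + r * C * η
        ≡⟨ cong (λ t → (+ 4 / 3) * seq Λ n + t * η) (*-inverseˡ C) ⟩
      (+ 4 / 3) * seq Λ n + 1ℚ * η
        ≡⟨ cong (λ t → (+ 4 / 3) * seq Λ n + t) (*-identityˡ η) ⟩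
      (+ 4 / 3) * seq Λ n + η ∎
  where
  k = bound p
  c = count k
  -- The total error is (4/3)(δ + c²δ) = Cδ, so δ = η/C makes it exactly η.
  C = (+ 4 / 3) * (1ℚ + c * c)
  0<C : 0ℚ < C
  0<C = *-positive (positive⁻¹ (+ 4 / 3))
    (<-≤-trans (positive⁻¹ 1ℚ) (p≤p+q (*-nonneg (count-nonneg k) (count-nonneg k))))
  instance
    C-positive : Positive C
    C-positive = positive 0<C
    C-nonZero : NonZero C
    C-nonZero = pos⇒nonZero C
  r = 1/ C
  δ = r * η
  0<δ : 0ℚ < δ
  0<δ = *-positive (positive⁻¹ r {{1/pos⇒pos C}}) 0<η

÷-≤ : ∀ {x y c} {{y>0 : 0ℝ ℝ.< y}} →
  (∀ η → 0ℚ < η → Eventually (λ n → seq x n ≤ c * seq y n + η)) → x ÷ y ℝ.≤ fromℚ c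
÷-≤ {x} {y} {c} {{ε₀ , 0<ε₀ , N₀ , ε₀≤y}} x≤ ε 0<ε =
  -- Since `y` is eventually at least `ε₀`, an error of `ε * ε₀` is at most `ε` after division by
  -- `y`.
  let N , f = (N₀ , ε₀≤y) ∧ x≤ (ε * ε₀) (*-positive 0<ε 0<ε₀)
  in N , λ n N≤n →
    let ε₀≤yₙ = subst (_≤ seq y n) (+-identityˡ ε₀) (proj₁ (f n N≤n))
        d = seq y n ⊔ ε₀
        r = recip ε₀ 0<ε₀ (seq y n)
        d≡yₙ = p≥q⇒p⊔q≡p ε₀≤yₙ
    in *-cancelʳ-≤-pos d {{positive (<-≤-trans 0<ε₀ (p≤q⊔p (seq y n) ε₀))}} (begin
      seq x n * r * d              ≡⟨ *-assoc (seq x n) r d ⟩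
      seq x n * (r * d)            ≡⟨ cong (seq x n *_) (recip-inverse ε₀ 0<ε₀ (seq y n)) ⟩
      seq x n * 1ℚ                 ≡⟨ *-identityʳ (seq x n) ⟩
      seq x n                      ≤⟨ proj₂ (f n N≤n) ⟩
      c * seq y n + ε * ε₀         ≤⟨ +-monoʳ-≤ (c * seq y n) (*-monoʳ (<⇒≤ 0<ε) ε₀≤yₙ) ⟩
      c * seq y n + ε * seq y n    ≡⟨ *-distribʳ-+ (seq y n) c ε ⟨
      (c + ε) * seq y n            ≡⟨ cong ((c + ε) *_) d≡yₙ ⟨
      (c + ε) * d                  ∎)

theorem4 : CompetitiveRatioAtMost twoSolutions (fromℚ (+ 4 / 3))
theorem4 p λ* (_ , ¬¬optimal) =
  ≤-stable {makespan twoSolutions p ÷ λ*} {fromℚ (+ 4 / 3)} λ ratio≰ →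
    ¬¬optimal λ (S , time≈λ*) → ratio≰
      (÷-≤ {makespan twoSolutions p} {λ*} {+ 4 / 3} (makespan-≤ p S λ* (proj₁ time≈λ*)))
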